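{- The union $\bigcup_{n\ge 0}S_{n,2}$ is not closed under taking classical permutation patterns. Consequently, it is not a classical permutation class.
   Context: $S_n$ is the set of permutations of $\{0,1,\ldots,n-1\}$, written as sequences of length $n$. $I_n$ is the set of inversion sequences of length $n$, i.e. integer sequences $\sigma=(\sigma_1,\ldots,\sigma_n)$ with $0\le\sigma_i<i$ for every $1\le i\le n$. For a finite integer sequence $\sigma$ of length $n$, $\Theta(\sigma)$ is the sequence of length $n$ defined by $\Theta(\sigma)_i=\#\{j<i:\sigma_j<\sigma_i\}$. $FP_n=\{\sigma\in I_n:\Theta(\sigma)=\sigma\}$ and $S_{n,2}=\{\sigma\in S_n:\Theta(\Theta(\sigma))\in FP_n\}$. A permutation $\rho\in S_m$ is a classical pattern of (is contained in) $\pi\in S_n$ if there are indices $i_1<\cdots<i_m$ such that $(\pi_{i_1},\ldots,\pi_{i_m})$ is order-isomorphic to $\rho$. A set of permutations is closed under taking classical patterns if it contains every classical pattern of each of its elements; a classical permutation class is a set of permutations closed under taking classical patterns. -}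

module Defs where

open import Data.Fin.Base as Fin using (Fin; toℕ)
import Data.Fin.Properties as Fin
open import Data.Fin.Permutation using (Permutation′; _⟨$⟩ʳ_)
open import Data.Integer.Base using (ℤ; +_; _≤_; _<_)
open import Data.Integer.Properties using (_<?_)
open import Data.List.Base using (List; length; lookup; tabulate; filter; allFin)
open import Data.Nat.Base using (ℕ; suc)
open import Data.Product.Base using (_×_; ∃-syntax; Σ-syntax)
open import Function.Bundles using (_⇔_)
open import Level using (0ℓ)
open import Relation.Binary.Core using (Rel)
open import Relation.Binary.PropositionalEquality.Core using (_≡_)
open import Relation.Nullary.Decidable using (_×-dec_)
open import Relation.Unary using (Pred; _∈_; _⊆_; ⋃)

-- Finite integer sequences of arbitrary length are lists over ℤ.  Positions
-- are 0-based: the entry σ_i of the usual 1-based notation is the entry at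
-- the position k : Fin (length σ) with toℕ k = i - 1.
Seq : Set
Seq = List ℤ

oneLine : ∀ {n} → Permutation′ n → Seq
oneLine π = tabulate (λ i → + toℕ (π ⟨$⟩ʳ i))

S : ℕ → Pred Seq 0ℓ
S n σ = ∃[ π ] oneLine {n} π ≡ σ

-- 0 ≤ σ_i < i for 1-based i.
I : ℕ → Pred Seq 0ℓ
I n σ = length σ ≡ n ×
        (∀ k → + 0 ≤ lookup σ k × lookup σ k < + suc (toℕ k))

-- Θ(σ)_i = #{ j < i : σ_j < σ_i }.
Θ : Seq → Seq
Θ σ = tabulate λ i →
  + length (filter (λ j → (j Fin.<? i) ×-dec (lookup σ j <? lookup σ i))
                   (allFin (length σ)))

FP : ℕ → Pred Seq 0ℓ
FP n σ = σ ∈ I n × Θ σ ≡ σ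

S[_,2] : ℕ → Pred Seq 0ℓ
S[ n ,2] σ = σ ∈ S n × Θ (Θ σ) ∈ FP n

-- The function e lists the indices i_1 < ⋯ < i_m, and the last component
-- says that (π_{i_1}, …, π_{i_m}) is order-isomorphic to ρ.  The relation
-- makes sense for all sequences; it is used below only for permutations.
_IsPatternOf_ : Rel Seq 0ℓ
ρ IsPatternOf π =
  Σ[ e ∈ (Fin (length ρ) → Fin (length π)) ]
    (∀ {a b} → a Fin.< b → e a Fin.< e b) ×
    (∀ a b → lookup ρ a < lookup ρ b ⇔ lookup π (e a) < lookup π (e b))

Permutations : Pred Seq 0ℓ
Permutations = ⋃ ℕ S

ClosedUnderPatterns : ∀ {ℓ} → Pred Seq ℓ → Set ℓ
ClosedUnderPatterns C =
  ∀ {ρ π} → ρ ∈ Permutations → π ∈ C → ρ IsPatternOf π → ρ ∈ C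

IsPermutationClass : ∀ {ℓ} → Pred Seq ℓ → Set ℓ
IsPermutationClass C = C ⊆ Permutations × ClosedUnderPatterns C

{-# OPTIONS --safe #-}

-- The permutation 34102 lies in S_{5,2}: Θ(34102) = 01002 and
-- Θ(01002) = 01004, which Θ fixes.  Deleting its entry 1 leaves the pattern
-- 2301, and Θ(2301) = 0101, Θ(0101) = 0102, Θ(0102) = 0103 ≠ 0102.

module Submission where

open import Defs
open import Data.Fin.Base as Fin using (Fin; toℕ; punchIn)
open import Data.Fin.Patterns using (0F; 1F; 2F; 3F; 4F)
import Data.Fin.Properties as Fin
open import Data.Fin.Permutation using (Permutation′; transpose; _∘ₚ_)
import Data.Integer.Base as ℤ
import Data.Integer.Properties as ℤ
open import Data.List.Base using (lookup)
open import Data.Nat.Base using (ℕ)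
open import Data.Product.Base using (_×_; _,_; proj₂)
open import Function.Base using (_∘_)
open import Function.Bundles using (mk⇔)
open import Relation.Binary.PropositionalEquality.Core using (refl)
open import Relation.Nullary.Decidable using (_×-dec_; _→-dec_; from-yes)
open import Relation.Nullary.Negation.Core using (¬_)
open import Relation.Unary using (⋃; _∈_; _∉_)

-- `∘ₚ` applies its left factor first, so 0, 1, 2, 3, 4 are sent to 3, 4, 1, 0, 2.
π₃₄₁₀₂ : Permutation′ 5
π₃₄₁₀₂ = transpose 0F 3F ∘ₚ transpose 1F 4F ∘ₚ transpose 1F 2F

π₂₃₀₁ : Permutation′ 4
π₂₃₀₁ = transpose 0F 2F ∘ₚ transpose 1F 3F

34102∈S₅,₂ : oneLine π₃₄₁₀₂ ∈ S[ 5 ,2]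
-- All terms are closed: the length and the fixed-point equation hold by evaluation, the bounds by a
-- decision procedure run over the five positions.
34102∈S₅,₂ = (π₃₄₁₀₂ , refl) , (refl , inBounds) , refl
  where
  σ = Θ (Θ (oneLine π₃₄₁₀₂))

  inBounds : ∀ k → ℤ.+ 0 ℤ.≤ lookup σ k × lookup σ k ℤ.< ℤ.+ ℕ.suc (toℕ k)
  inBounds = from-yes (Fin.all? λ k →
    (ℤ.+ 0 ℤ.≤? lookup σ k) ×-dec (lookup σ k ℤ.<? ℤ.+ ℕ.suc (toℕ k)))

2301∉⋃Sₙ,₂ : oneLine π₂₃₀₁ ∉ ⋃ ℕ S[_,2]
-- The fixed-point equation does not mention the length index, so one refutation serves every index:
-- it evaluates to 0103 = 0102, whose last entries clash.
2301∉⋃Sₙ,₂ (_ , _ , _ , ())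

2301-isPatternOf-34102 : oneLine π₂₃₀₁ IsPatternOf oneLine π₃₄₁₀₂
2301-isPatternOf-34102 =
  e , increasing _ _ , λ a b → mk⇔ (preserves a b) (reflects a b)
  where
  ρ = oneLine π₂₃₀₁
  π = oneLine π₃₄₁₀₂

  e : Fin 4 → Fin 5
  -- Skips position 2, which holds the entry 1; what remains is 3402, order-isomorphic to 2301.
  e = punchIn 2F

  increasing : ∀ a b → a Fin.< b → e a Fin.< e b
  increasing = from-yes (Fin.all? λ a → Fin.all? λ b →
    (a Fin.<? b) →-dec (e a Fin.<? e b))

  preserves : ∀ a b → lookup ρ a ℤ.< lookup ρ b → lookup π (e a) ℤ.< lookup π (e b)
  -- Decided by checking all sixteen pairs of positions.
  preserves = from-yes (Fin.all? λ a → Fin.all? λ b →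
    (lookup ρ a ℤ.<? lookup ρ b) →-dec (lookup π (e a) ℤ.<? lookup π (e b)))

  reflects : ∀ a b → lookup π (e a) ℤ.< lookup π (e b) → lookup ρ a ℤ.< lookup ρ b
  reflects = from-yes (Fin.all? λ a → Fin.all? λ b →
    (lookup π (e a) ℤ.<? lookup π (e b)) →-dec (lookup ρ a ℤ.<? lookup ρ b))

proposition6p1 : ¬ ClosedUnderPatterns (⋃ ℕ S[_,2]) × ¬ IsPermutationClass (⋃ ℕ S[_,2])
proposition6p1 = notClosed , notClosed ∘ proj₂
  where
  notClosed : ¬ ClosedUnderPatterns (⋃ ℕ S[_,2])
  notClosed closed = 2301∉⋃Sₙ,₂
    (closed (4 , π₂₃₀₁ , refl) (5 , 34102∈S₅,₂) 2301-isPatternOf-34102)
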